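{- Let $k\ge1$ and $n\ge4$ be integers. The rank over $\mathbb{Z}_2$ of any $(n,k)$-matrix is at least $(n-3)^2/2^k$.
   Context: $[n]=\{1,\dots,n\}$. A $k$-octahedron is a tuple $P=P_1*\dots*P_{k+1}$ of 2-element subsets $P_i\subset[n]$, identified with the set of $k$-faces $\{(1,a_1),\dots,(k+1,a_{k+1})\}$, $a_i\in P_i$, of the complex $[n]^{*k+1}$ (vertex set $[k+1]\times[n]$, $k$-faces spanned by one vertex from each $\{i\}\times[n]$). $P,Q$ are vertex-disjoint if $P_i\cap Q_i=\emptyset$ for all $i$; $\oplus$ is symmetric difference of sets of $k$-faces. An $(n,k)$-matrix is a $\mathbb{Z}_2$-matrix $A$ indexed (rows and columns) by all $k$-octahedra such that: $A$ is symmetric; $A_{P,Q}=0$ whenever $P,Q$ are vertex-disjoint; $A_{P,Q}=A_{X,Q}+A_{Y,Q}$ whenever $P=X\oplus Y$ for $k$-octahedra $X,Y$; and $\sum A_{P,Q}=1$, the sum over all unordered pairs $\{P,Q\}$ of $k$-octahedra with $P_i,Q_i\subset[3]$ and $P_i\cap Q_i=\{1\}$ for all $i\in[k+1]$. -}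

module Defs where

open import Data.Nat using (ℕ; zero; suc; _+_; _*_; _∸_; _^_; _≤_)
open import Data.Fin using (Fin; zero; suc; _<_; _≟_)
open import Data.Fin.Properties using ()
open import Data.Bool using (Bool; true; false; _xor_; _∧_; _∨_; not; if_then_else_)
open import Data.Vec.Functional using (_∷_)
open import Data.Sum using (_⊎_)
open import Data.Product using (Σ; _×_; ∃-syntax)
open import Data.Empty using (⊥)
open import Relation.Nullary.Decidable using (⌊_⌋)
open import Relation.Binary.PropositionalEquality using (_≡_)
open import Data.Nat.Base using (z≤n; s≤s)
open import Data.Fin.Base using (toℕ)

-- A 2-element subset {a , b} of [n] (here Fin n), stored with a < b.
record Pair (n : ℕ) : Set where
  constructor ⟨_,_∣_⟩
  field
    a   : Fin n
    b   : Fin n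
    a<b : a < b
open Pair public

_∈₂_ : {n : ℕ} → Fin n → Pair n → Set
x ∈₂ p = x ≡ a p ⊎ x ≡ b p

_∈₂?_ : {n : ℕ} → Fin n → Pair n → Bool
x ∈₂? p = ⌊ x ≟ a p ⌋ ∨ ⌊ x ≟ b p ⌋

-- A k-octahedron P = P_1 * ... * P_{k+1} in [n]^{*k+1}
Oct : ℕ → ℕ → Set
Oct k n = Fin (suc k) → Pair n

-- a k-face of [n]^{*k+1}: one vertex from each {i} × [n]
Face : ℕ → ℕ → Set
Face k n = Fin (suc k) → Fin n

andAll : (m : ℕ) → (Fin m → Bool) → Bool
andAll zero    f = true
andAll (suc m) f = f zero ∧ andAll m (λ i → f (suc i))

xorSum : (m : ℕ) → (Fin m → Bool) → Bool
xorSum zero    f = false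
xorSum (suc m) f = f zero xor xorSum m (λ i → f (suc i))

xorSumFun : (m : ℕ) → ((Fin m → Bool) → Bool) → Bool
xorSumFun zero    F = F (λ ())
xorSumFun (suc m) F = xorSumFun m (λ t → F (false ∷ t)) xor xorSumFun m (λ t → F (true ∷ t))

faceIn : {k n : ℕ} → Oct k n → Face k n → Bool
faceIn {k} P f = andAll (suc k) (λ i → f i ∈₂? P i)

VertexDisjoint : {k n : ℕ} → Oct k n → Oct k n → Set
VertexDisjoint P Q = ∀ i x → x ∈₂ P i → x ∈₂ Q i → ⊥

IsSymDiff : {k n : ℕ} → Oct k n → Oct k n → Oct k n → Set
IsSymDiff P X Y = ∀ f → faceIn P f ≡ (faceIn X f xor faceIn Y f)

-- Z₂-matrices indexed by k-octahedra (Bool = Z₂, xor = +, ∧ = ·)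
Matrix : ℕ → ℕ → Set
Matrix k n = Oct k n → Oct k n → Bool

-- The normalisation sum.  Unordered pairs {P,Q} with P_i,Q_i ⊆ [3] and
-- P_i ∩ Q_i = {1} for all i: each coordinate is ({1,2},{1,3}) or
-- ({1,3},{1,2}); an unordered pair is listed exactly once by fixing
-- P_1 = {1,2} and choosing P_i for i ≥ 2 freely (Q_i is then the other one).
-- For n < 3 there are no such pairs, the sum is 0 ≠ 1, so the condition fails.
NormSum : {k n : ℕ} → Matrix k n → Set
NormSum {k} {suc (suc (suc m))} A =
  xorSumFun k (λ t → A (oct (false ∷ t)) (oct (λ i → not ((false ∷ t) i)))) ≡ true
  where
    p12 : Pair (suc (suc (suc m)))
    p12 = ⟨ zero , suc zero ∣ s≤s z≤n ⟩
    p13 : Pair (suc (suc (suc m)))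
    p13 = ⟨ zero , suc (suc zero) ∣ s≤s z≤n ⟩
    oct : (Fin (suc k) → Bool) → Oct k (suc (suc (suc m)))
    oct s i = if s i then p13 else p12
NormSum {k} {_} A = ⊥

record IsNKMatrix (n k : ℕ) (A : Matrix k n) : Set where
  field
    symmetric : ∀ P Q → A P Q ≡ A Q P
    disjoint  : ∀ P Q → VertexDisjoint P Q → A P Q ≡ false
    additive  : ∀ P X Y Q → IsSymDiff P X Y → A P Q ≡ (A X Q xor A Y Q)
    normalised : NormSum A

RowsIndependent : {k n : ℕ} → Matrix k n → (r : ℕ) → (Fin r → Oct k n) → Set
RowsIndependent A r R =
  (c : Fin r → Bool) →
  (∀ Q → xorSum r (λ j → c j ∧ A (R j) Q) ≡ false) →
  ∀ j → c j ≡ false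

RankAtLeast : {k n : ℕ} → Matrix k n → ℕ → Set
RankAtLeast {k} {n} A r = Σ (Fin r → Oct k n) (RowsIndependent A r)

{-# OPTIONS --safe #-}
module Submission where

-- Write e_b = {1,b} for the pairs through the vertex 1, and for a ≥ 3 let p_a =
-- {1,a} and q_a = {2,a}: p_a and q_a share one vertex, while p_a and q_a′ are
-- disjoint for a ≠ a′. Let M be the matrix with rows (a,b), columns (a′,b′) and
-- entries the sum, over the 2^(k-1) ways of picking p or q in coordinates 2,
-- ..., k, of A at the octahedron with e_b first, the picks from {p_a, q_a} and
-- p_a last, and the one with e_b′ first, the opposite picks from {p_a′, q_a′}
-- and q_a′ last. Then rk M ≤ 2^(k-1) rk A. Additivity and vanishing on disjoint
-- pairs show that the normalisation sum is the same for all triples of vertices,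
-- so each diagonal block of M is a tournament matrix T (T + Tᵗ is 1 off the
-- diagonal), and each other block is constant off its diagonal. A matrix of rank
-- at most n - 3 removes these constants below the block diagonal. What remains
-- has n - 2 blocks of size n - 1, tournaments on the diagonal and diagonal
-- matrices below, and Gaussian elimination bounds its rank from below by
-- (n-2)²/2, as if the blocks below were zero. Hence 2^k rk A ≥ (n-2)² - 2(n-3) =
-- (n-3)² + 1.

open import Defs
open import Data.Nat using (ℕ; zero; suc; _+_; _≤_; _∸_; _^_; _*_; z≤n; s≤s)
open import Data.Nat.Properties using (≤-trans; ≤-reflexive; ≤-irrelevant; n≤1+n; +-mono-≤; +-suc; +-identityʳ; +-cancelʳ-≤; module ≤-Reasoning)
open import Data.Nat.Solver using (module +-*-Solver)
open import Data.Fin using (Fin; zero; suc; _<_; _≟_; _<?_; combine; remQuot; finToFun; funToFin)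
open import Data.Fin.Properties using (any?; <-cmp; <-trans; <-irrefl; <⇒≢; suc-injective; remQuot-combine; finToFun-funToFin)
open import Data.Bool using (Bool; true; false; _xor_; _∧_; not; if_then_else_)
open import Data.Bool.Properties using (xor-same; xor-comm; xor-identityʳ; ∧-comm; ∧-zeroʳ; ∧-identityʳ; ¬-not; ∧-distribˡ-xor; ∧-distribʳ-xor)
import Data.Bool.Properties as Bool
open import Data.Bool.Solver using (module xor-∧-Solver)
open import Data.Vec.Functional using (_∷_; updateAt)
open import Data.Sum using (_⊎_; inj₁; inj₂)
open import Data.Product using (Σ; ∃; ∃-syntax; _×_; _,_; proj₁; proj₂; uncurry)
open import Data.Empty using (⊥)
open import Function using (_∘_; flip)
open import Relation.Nullary using (yes; no; does; contradiction)
open import Relation.Nullary.Decidable using (dec-true; dec-false)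
open import Relation.Binary using (tri<; tri≈; tri>)
open import Relation.Binary.PropositionalEquality using (_≡_; _≢_; _≗_; refl; sym; trans; cong; cong₂; subst; module ≡-Reasoning)

private
  variable
    X Y X₀ Y₀ : Set
    n m s t : ℕ

-- Arithmetic of the bounds

module _ where
  open +-*-Solver

  regroup : ∀ t u n → suc (t + t) + ((u + u) + n) ≡ ((t + u) + (t + u)) + suc n
  regroup = solve 3 (λ t u n →
    (con 1 :+ (t :+ t)) :+ ((u :+ u) :+ n) := ((t :+ u) :+ (t :+ u)) :+ (con 1 :+ n)) refl

  double : ∀ w r → w * (r + r) ≡ 2 * w * r
  double = solve 2 (λ w r → w :* (r :+ r) := con 2 :* w :* r) refl

  complete-square : ∀ j → suc (suc j ^ 2) + (2 * suc j + suc (suc j)) ≡ (2 + j) * (3 + j)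
  complete-square = solve 1 (λ j →
    con 1 :+ (con 1 :+ j) :^ 2 :+ (con 2 :* (con 1 :+ j) :+ (con 2 :+ j)) :=
    (con 2 :+ j) :* (con 3 :+ j)) refl

  collect : ∀ w r j → (w * r + suc j) + (w * r + suc j) + (2 + j) ≡ 2 * w * r + (2 * suc j + suc (suc j))
  collect = solve 3 (λ w r j →
    (w :* r :+ (con 1 :+ j)) :+ (w :* r :+ (con 1 :+ j)) :+ (con 2 :+ j) :=
    con 2 :* w :* r :+ (con 2 :* (con 1 :+ j) :+ (con 2 :+ j))) refl

-- Rank by factorisation and its behaviour under elimination

open xor-∧-Solver using (solve; _:+_; _:*_; _:=_; con)

-- Rank as a number of rank-one terms: `s` products of a column `f` and a row `g` reduce `M` to
-- zero. In this form it makes sense for infinite index types.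
RankAtMost : ℕ → (X → Y → Bool) → Set
RankAtMost zero    M = ∀ x y → M x y ≡ false
RankAtMost {X} {Y} (suc s) M =
  Σ (X → Bool) λ f → Σ (Y → Bool) λ g →
  RankAtMost s (λ x y → M x y xor (f x ∧ g y))

rank-cong : {M M′ : X → Y → Bool} → (∀ x y → M x y ≡ M′ x y) →
  RankAtMost s M → RankAtMost s M′
rank-cong {s = zero}  eq M≤ x y = trans (sym (eq x y)) (M≤ x y)
rank-cong {s = suc s} eq (f , g , M≤) =
  f , g , rank-cong (λ x y → cong (_xor (f x ∧ g y)) (eq x y)) M≤

rank-reindex : {M : X → Y → Bool} (φ : X₀ → X) (ψ : Y₀ → Y) →
  RankAtMost s M → RankAtMost s (λ x y → M (φ x) (ψ y))
rank-reindex {s = zero}  φ ψ M≤ x y = M≤ (φ x) (ψ y)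
rank-reindex {s = suc s} φ ψ (f , g , M≤) = f ∘ φ , g ∘ ψ , rank-reindex φ ψ M≤

rank-transpose : {M : X → Y → Bool} → RankAtMost s M → RankAtMost s (flip M)
rank-transpose {s = zero}  M≤ y x = M≤ x y
rank-transpose {s = suc s} {M = M} (f , g , M≤) =
  g , f , rank-cong (λ y x → cong (M x y xor_) (∧-comm (f x) (g y))) (rank-transpose M≤)

rank-xor : {M M′ : X → Y → Bool} → RankAtMost s M → RankAtMost t M′ →
  RankAtMost (s + t) (λ x y → M x y xor M′ x y)
rank-xor {s = zero}  M≤ M′≤ =
  rank-cong (λ x y → cong (_xor _) (sym (M≤ x y))) M′≤
rank-xor {s = suc s} {M = M} {M′} (f , g , M≤) M′≤ =
  f , g , rank-cong
    (λ x y → solve 3 (λ m m′ h → (m :+ h) :+ m′ := (m :+ m′) :+ h) refl (M x y) (M′ x y) (f x ∧ g y))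
    (rank-xor M≤ M′≤)

rank-rowOp : {M : X → Y → Bool} (h : X → Bool) (x₀ : X) →
  RankAtMost s M → RankAtMost s (λ x y → M x y xor (h x ∧ M x₀ y))
rank-rowOp {s = zero} h x₀ M≤ x y rewrite M≤ x y | M≤ x₀ y = ∧-zeroʳ (h x)
rank-rowOp {s = suc s} {M = M} h x₀ (f , g , M≤) =
  (λ x → f x xor (h x ∧ f x₀)) , g , rank-cong
    (λ x y → solve 6 (λ m m₀ h f f₀ g →
      (m :+ f :* g) :+ h :* (m₀ :+ f₀ :* g) := (m :+ h :* m₀) :+ (f :+ h :* f₀) :* g)
      refl (M x y) (M x₀ y) (h x) (f x) (f x₀) (g y))
    (rank-rowOp h x₀ M≤)

rank-columnOp : {M : X → Y → Bool} (h : Y → Bool) (y₀ : Y) →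
  RankAtMost s M → RankAtMost s (λ x y → M x y xor (M x y₀ ∧ h y))
rank-columnOp {M = M} h y₀ M≤ =
  rank-cong (λ x y → cong (M x y xor_) (∧-comm (h y) (M x y₀)))
    (rank-transpose (rank-rowOp h y₀ (rank-transpose M≤)))

schur : (X → Y → Bool) → X → Y → X → Y → Bool
schur M x₀ y₀ x y = M x y xor (M x y₀ ∧ M x₀ y)

-- Induction on the rank-one terms. A term with `f x₀` or `g y₀` equal to `false` leaves the pivot
-- intact and survives with its other factor adjusted. A term with both equal to `true` is used up,
-- and this is the unit of rank that is lost.
rank-schur : {M : X → Y → Bool} (x₀ : X) (y₀ : Y) → M x₀ y₀ ≡ true →
  RankAtMost s M → ∃[ s′ ] s ≡ suc s′ × RankAtMost s′ (schur M x₀ y₀)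
rank-schur {s = zero} x₀ y₀ pivot M≤ with () ← trans (sym pivot) (M≤ x₀ y₀)
rank-schur {s = suc s} {M = M} x₀ y₀ pivot (f , g , M≤) with f x₀ in f₀ | g y₀ in g₀
... | false | g₀′ with s′ , refl , M′≤ ← rank-schur x₀ y₀
    (trans (cong (λ b → M x₀ y₀ xor (b ∧ g y₀)) f₀) (trans (xor-identityʳ _) pivot)) M≤
  = suc s′ , refl , f , (λ y → g y xor (g y₀ ∧ M x₀ y)) , rank-cong eq M′≤
  where
  eq : ∀ x y → schur (λ x y → M x y xor (f x ∧ g y)) x₀ y₀ x y ≡
               schur M x₀ y₀ x y xor (f x ∧ (g y xor (g y₀ ∧ M x₀ y)))
  eq x y rewrite f₀ =
    solve 6 (λ m a b f g g₀ →
      (m :+ f :* g) :+ (a :+ f :* g₀) :* (b :+ con false) := (m :+ a :* b) :+ f :* (g :+ g₀ :* b))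
      refl (M x y) (M x y₀) (M x₀ y) (f x) (g y) (g y₀)
... | true | false with s′ , refl , M′≤ ← rank-schur x₀ y₀
    (trans (cong₂ (λ a b → M x₀ y₀ xor (a ∧ b)) f₀ g₀) (trans (xor-identityʳ _) pivot)) M≤
  = suc s′ , refl , (λ x → f x xor (M x y₀ ∧ f x₀)) , g , rank-cong eq M′≤
  where
  eq : ∀ x y → schur (λ x y → M x y xor (f x ∧ g y)) x₀ y₀ x y ≡
               schur M x₀ y₀ x y xor ((f x xor (M x y₀ ∧ f x₀)) ∧ g y)
  eq x y rewrite g₀ =
    solve 6 (λ m a b f g f₀ →
      (m :+ f :* g) :+ (a :+ f :* con false) :* (b :+ f₀ :* g) := (m :+ a :* b) :+ (f :+ a :* f₀) :* g)
      refl (M x y) (M x y₀) (M x₀ y) (f x) (g y) (f x₀)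
-- The row operation turns the term `f ∧ g` into `f` times row `x₀` of `M`; the column operation
-- then replaces `f` by column `y₀` of `M`.
... | true | true = s , refl , rank-cong eq (rank-columnOp (λ y → M x₀ y) y₀ (rank-rowOp f x₀ M≤))
  where
  eq : ∀ x y →
    ((M x y xor (f x ∧ g y)) xor (f x ∧ (M x₀ y xor (f x₀ ∧ g y)))) xor
    (((M x y₀ xor (f x ∧ g y₀)) xor (f x ∧ (M x₀ y₀ xor (f x₀ ∧ g y₀)))) ∧ M x₀ y) ≡
    schur M x₀ y₀ x y
  eq x y rewrite f₀ | g₀ | pivot =
    solve 5 (λ m a b f g →
      ((m :+ f :* g) :+ f :* (b :+ g)) :+ ((a :+ f :* con true) :+ f :* con false) :* b := m :+ a :* b)
      refl (M x y) (M x y₀) (M x₀ y) (f x) (g y)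

rank-extendByZeroRow : ∀ {p} {M : Fin (suc p) → Y → Bool} → (∀ y → M zero y ≡ false) →
  RankAtMost s (M ∘ suc) → RankAtMost s M
rank-extendByZeroRow {s = zero}  M₀ M≤ zero    y = M₀ y
rank-extendByZeroRow {s = zero}  M₀ M≤ (suc x) y = M≤ x y
rank-extendByZeroRow {s = suc s} {M = M} M₀ (f , g , M≤) =
  (false ∷ f) , g , rank-extendByZeroRow (λ y → trans (xor-identityʳ (M zero y)) (M₀ y)) M≤

rank-rows : ∀ {p} (M : Fin p → Y → Bool) → RankAtMost p M
rank-rows {p = zero}  M ()
rank-rows {p = suc p} M =
  (true ∷ λ _ → false) , M zero , rank-extendByZeroRow (λ y → xor-same (M zero y))
    (rank-cong (λ x y → sym (xor-identityʳ (M (suc x) y))) (rank-rows (M ∘ suc)))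

-- Gaussian elimination and independent rows

decideTrue : ∀ {q} (g : Fin q → Bool) → (∃ λ y → g y ≡ true) ⊎ (∀ y → g y ≡ false)
decideTrue g with any? (λ y → g y Bool.≟ true)
... | yes found  = inj₁ found
... | no  ∄true = inj₂ λ y → ¬-not λ gy → ∄true (y , gy)

xorSum-cong : ∀ r {f g : Fin r → Bool} → (∀ j → f j ≡ g j) → xorSum r f ≡ xorSum r g
xorSum-cong zero    eq = refl
xorSum-cong (suc r) eq = cong₂ _xor_ (eq zero) (xorSum-cong r (eq ∘ suc))

xorSum-axpy : ∀ r (f g : Fin r → Bool) b →
  xorSum r (λ j → f j xor (g j ∧ b)) ≡ xorSum r f xor (xorSum r g ∧ b)
xorSum-axpy zero    f g b = refl
xorSum-axpy (suc r) f g b rewrite xorSum-axpy r (f ∘ suc) (g ∘ suc) b =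
  solve 5 (λ f g F G b → (f :+ g :* b) :+ (F :+ G :* b) := (f :+ F) :+ (g :+ G) :* b)
    refl (f zero) (g zero) (xorSum r (f ∘ suc)) (xorSum r (g ∘ suc)) b

xorSum-zeroCoefficients : ∀ r (c g : Fin r → Bool) → (∀ j → c j ≡ false) →
  xorSum r (λ j → c j ∧ g j) ≡ false
xorSum-zeroCoefficients zero    c g c≡0 = refl
xorSum-zeroCoefficients (suc r) c g c≡0 rewrite c≡0 zero =
  xorSum-zeroCoefficients r (c ∘ suc) (g ∘ suc) (c≡0 ∘ suc)

Independent : ∀ {r} → (Fin r → Y → Bool) → Set
Independent {r = r} rows =
  (c : Fin r → Bool) → (∀ y → xorSum r (λ j → c j ∧ rows j y) ≡ false) → ∀ j → c j ≡ false

-- The same `r` bounds the factorisation rank from above and counts independent rows, so a lower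
-- bound proved for factorisations passes to independent rows.
gauss : ∀ {p q} (M : Fin p → Fin q → Bool) →
  ∃ λ r → RankAtMost r M × Σ (Fin r → Fin p) λ ρ → Independent (M ∘ ρ)
gauss {zero}  M = 0 , (λ ()) , (λ ()) , λ _ _ ()
gauss {suc p} M with decideTrue (M zero)
... | inj₂ M₀ with r , M≤ , ρ , indep ← gauss (M ∘ suc) =
  r , rank-extendByZeroRow M₀ M≤ , suc ∘ ρ , indep
... | inj₁ (y₀ , pivot) with r , M≤ , ρ , indep ← gauss (schur M zero y₀ ∘ suc) =
  suc r , ((λ x → M x y₀) , M zero , rank-extendByZeroRow zeroRow M≤) , (zero ∷ (suc ∘ ρ)) , indep′
  where
  zeroRow : ∀ y → schur M zero y₀ zero y ≡ false
  zeroRow y rewrite pivot = xor-same (M zero y)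

  -- The value of a vanishing combination at the pivot column is the total
  -- coefficient of row zero after the elimination.
  indep′ : Independent (M ∘ (zero ∷ (suc ∘ ρ)))
  indep′ c vanishes = λ { zero → c₀≡0 ; (suc j) → tail≡0 j }
    where
    tail≡0 : ∀ j → c (suc j) ≡ false
    tail≡0 = indep (c ∘ suc) λ y → begin
      xorSum r (λ j → c (suc j) ∧ schur M zero y₀ (suc (ρ j)) y)
        ≡⟨ xorSum-cong r (λ j → solve 4 (λ c m a b → c :* (m :+ a :* b) := c :* m :+ (c :* a) :* b)
             refl (c (suc j)) (M (suc (ρ j)) y) (M (suc (ρ j)) y₀) (M zero y)) ⟩
      xorSum r (λ j → (c (suc j) ∧ M (suc (ρ j)) y) xor ((c (suc j) ∧ M (suc (ρ j)) y₀) ∧ M zero y))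
        ≡⟨ xorSum-axpy r _ _ (M zero y) ⟩
      tailSum y xor (tailSum y₀ ∧ M zero y)
        -- The term of row zero is inserted twice, which adds nothing over Z₂, so that both brackets
        -- become instances of `vanishes`.
        ≡⟨ solve 4 (λ c m F G → F :+ G :* m := (c :* m :+ F) :+ (c :* con true :+ G) :* m)
             refl (c zero) (M zero y) (tailSum y) (tailSum y₀) ⟩
      ((c zero ∧ M zero y) xor tailSum y) xor (((c zero ∧ true) xor tailSum y₀) ∧ M zero y)
        ≡⟨ cong (λ b → ((c zero ∧ M zero y) xor tailSum y) xor (((c zero ∧ b) xor tailSum y₀) ∧ M zero y)) (sym pivot) ⟩
      ((c zero ∧ M zero y) xor tailSum y) xor (((c zero ∧ M zero y₀) xor tailSum y₀) ∧ M zero y)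
        ≡⟨ cong₂ (λ a b → a xor (b ∧ M zero y)) (vanishes y) (vanishes y₀) ⟩
      false ∎
      where
      open ≡-Reasoning
      tailSum : _ → Bool
      tailSum y = xorSum r (λ j → c (suc j) ∧ M (suc (ρ j)) y)

    c₀≡0 : c zero ≡ false
    c₀≡0 = begin
      c zero                        ≡⟨ sym (∧-identityʳ (c zero)) ⟩
      c zero ∧ true                 ≡⟨ cong (c zero ∧_) (sym pivot) ⟩
      c zero ∧ M zero y₀            ≡⟨ sym (xor-identityʳ _) ⟩
      (c zero ∧ M zero y₀) xor false
        ≡⟨ cong ((c zero ∧ M zero y₀) xor_) (sym (xorSum-zeroCoefficients r (c ∘ suc) _ tail≡0)) ⟩
      (c zero ∧ M zero y₀) xor xorSum r (λ j → c (suc j) ∧ M (suc (ρ j)) y₀)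
        ≡⟨ vanishes y₀ ⟩
      false ∎
      where open ≡-Reasoning

-- Searching for pivots and splitting along a zero block

rank-mask : {M : X → Y → Bool} (u : X → Bool) (v : Y → Bool) →
  RankAtMost s M → RankAtMost s (λ x y → (u x ∧ v y) ∧ M x y)
rank-mask {s = zero}  u v M≤ x y rewrite M≤ x y = ∧-zeroʳ (u x ∧ v y)
rank-mask {s = suc s} {M = M} u v (f , g , M≤) =
  (λ x → u x ∧ f x) , (λ y → v y ∧ g y) , rank-cong
    (λ x y → solve 5 (λ u v m f g → (u :* v) :* (m :+ f :* g) := (u :* v) :* m :+ (u :* f) :* (v :* g))
      refl (u x) (v y) (M x y) (f x) (g y))
    (rank-mask u v M≤)

search : ∀ {m} {P Q : Fin m → Set} → (∀ i → P i ⊎ Q i) → ∃ P ⊎ (∀ i → Q i)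
search {zero}  P⊎Q = inj₂ λ ()
search {suc m} P⊎Q with P⊎Q zero | search (P⊎Q ∘ suc)
... | inj₁ p | _            = inj₁ (zero , p)
... | inj₂ _ | inj₁ (i , p) = inj₁ (suc i , p)
... | inj₂ q | inj₂ qs      = inj₂ λ { zero → q ; (suc i) → qs i }

lastTrue : ∀ {m} (g : Fin m → Bool) →
  (∃ λ i → g i ≡ true × (∀ j → i < j → g j ≡ false)) ⊎ (∀ i → g i ≡ false)
lastTrue {zero}  g = inj₂ λ ()
lastTrue {suc m} g with lastTrue (g ∘ suc) | g zero in g₀
... | inj₁ (i , gi , last) | _ = inj₁ (suc i , gi , λ { (suc j) (s≤s i<j) → last j i<j })
... | inj₂ none | true  = inj₁ (zero , g₀ , λ { (suc j) _ → none j })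
... | inj₂ none | false = inj₂ λ { zero → g₀ ; (suc i) → none i }

-- Pivots are taken in block 1 until it vanishes. Each lies in a column that is zero on the rows
-- `φ₀`, so block 0 never changes and the rank left over bounds it.
rank-split : (M : X → Y → Bool) (φ₀ : X₀ → X) (ψ₀ : Y₀ → Y)
  {p q : ℕ} (φ₁ : Fin p → X) (ψ₁ : Fin q → Y) →
  (∀ x y → M (φ₀ x) (ψ₁ y) ≡ false) → RankAtMost s M →
  ∃ λ t₁ → ∃ λ t₀ → t₁ + t₀ ≡ s ×
  RankAtMost t₁ (λ x y → M (φ₁ x) (ψ₁ y)) × RankAtMost t₀ (λ x y → M (φ₀ x) (ψ₀ y))
rank-split {s = s} M φ₀ ψ₀ φ₁ ψ₁ M₀₁ M≤
  with search (λ x → decideTrue (λ y → M (φ₁ x) (ψ₁ y)))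
... | inj₂ zeroBlock = 0 , s , refl , zeroBlock , rank-reindex φ₀ ψ₀ M≤
... | inj₁ (x₁ , y₁ , pivot) with rank-schur (φ₁ x₁) (ψ₁ y₁) pivot M≤
...   | s′ , refl , M′≤
  with rank-split (schur M (φ₁ x₁) (ψ₁ y₁)) φ₀ ψ₀ φ₁ ψ₁
    (λ x y → cong₂ (λ a b → a xor (b ∧ M (φ₁ x₁) (ψ₁ y))) (M₀₁ x y) (M₀₁ x y₁)) M′≤
...   | t₁ , t₀ , sum , M₁≤ , M₀≤ =
  suc t₁ , t₀ , cong suc sum ,
  ((λ x → M (φ₁ x) (ψ₁ y₁)) , (λ y → M (φ₁ x₁) (ψ₁ y)) , M₁≤) , rank-cong
    (λ x y → trans (cong (λ b → M (φ₀ x) (ψ₀ y) xor (b ∧ M (φ₁ x₁) (ψ₀ y))) (M₀₁ x y₁)) (xor-identityʳ _))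
    M₀≤

-- Ranks of identity and tournament matrices

count : ∀ {m} → (Fin m → Bool) → ℕ
count {zero}  p = 0
count {suc m} p = (if p zero then 1 else 0) + count (p ∘ suc)

count-cong : ∀ {m} {p p′ : Fin m → Bool} → (∀ b → p b ≡ p′ b) → count p ≡ count p′
count-cong {zero}  eq = refl
count-cong {suc m} eq = cong₂ (λ b c → (if b then 1 else 0) + c) (eq zero) (count-cong (eq ∘ suc))

count-none : ∀ {m} (p : Fin m → Bool) → (∀ b → p b ≡ false) → count p ≡ 0
count-none {zero}  p none = refl
count-none {suc m} p none rewrite none zero = count-none (p ∘ suc) (none ∘ suc)

count-all : ∀ m → count {m} (λ _ → true) ≡ m
count-all zero    = refl
count-all (suc m) = cong suc (count-all m)

remove : ∀ {m} → Fin m → (Fin m → Bool) → Fin m → Bool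
remove b₀ p b = p b ∧ not (does (b ≟ b₀))

remove⁻ : ∀ {m} {b₀ : Fin m} (p : Fin m → Bool) {b} → remove b₀ p b ≡ true → p b ≡ true × b ≢ b₀
remove⁻ {b₀ = b₀} p {b} kept with p b | b ≟ b₀
remove⁻ p ()   | true  | yes _
remove⁻ p kept | true  | no b≢b₀ = refl , b≢b₀
remove⁻ p ()   | false | _

count-remove : ∀ {m} (p : Fin m → Bool) b₀ → p b₀ ≡ true → count p ≡ suc (count (remove b₀ p))
count-remove {suc m} p zero pb₀ rewrite pb₀ =
  cong suc (count-cong (λ b → sym (∧-identityʳ (p (suc b)))))
count-remove {suc m} p (suc b₀) pb₀ with p zero
... | true  = cong suc (count-remove (p ∘ suc) b₀ pb₀)
... | false = count-remove (p ∘ suc) b₀ pb₀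

corrected : ∀ {x} a b → a ∧ b ≡ false → x xor (a ∧ b) ≡ x
corrected {x} a b eq = trans (cong (x xor_) eq) (xor-identityʳ x)

∧-false : ∀ a {b} → b ≡ false → a ∧ b ≡ false
∧-false a refl = ∧-zeroʳ a

-- A diagonal pivot changes nothing on the remaining indices, so each unit of rank removes a single
-- index.
rank-identity : ∀ {m} (K : Fin m → Fin m → Bool) (p : Fin m → Bool) →
  (∀ {b} → p b ≡ true → K b b ≡ true) →
  (∀ {b b′} → p b ≡ true → p b′ ≡ true → b ≢ b′ → K b b′ ≡ false) →
  RankAtMost s K → count p ≤ s
rank-identity K p one off K≤ with decideTrue p
... | inj₂ none rewrite count-none p none = z≤n
... | inj₁ (b₀ , pb₀) with rank-schur b₀ b₀ (one pb₀) K≤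
...   | s′ , refl , K′≤ rewrite count-remove p b₀ pb₀ =
  s≤s (rank-identity (schur K b₀ b₀) (remove b₀ p)
    (λ {b} kept → let pb , b≢b₀ = remove⁻ p kept in
      trans (corrected (K b b₀) (K b₀ b) (cong (_∧ K b₀ b) (off pb pb₀ b≢b₀))) (one pb))
    (λ {b} {b′} kept kept′ b≢b′ →
      let pb , b≢b₀ = remove⁻ p kept ; pb′ , _ = remove⁻ p kept′ in
      trans (corrected (K b b₀) (K b₀ b′) (cong (_∧ K b₀ b′) (off pb pb₀ b≢b₀))) (off pb pb′ b≢b′))
    K′≤)

-- One elimination step turns J + I into the identity.
rank-J+I : ∀ {m} (K : Fin m → Fin m → Bool) (p : Fin m → Bool) →
  (∀ b → K b b ≡ false) →
  (∀ {b b′} → p b ≡ true → p b′ ≡ true → b ≢ b′ → K b b′ ≡ true) →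
  RankAtMost s K → count p ≤ suc s
rank-J+I K p zeroDiagonal one K≤ with decideTrue p
... | inj₂ none rewrite count-none p none = z≤n
... | inj₁ (b₀ , pb₀) rewrite count-remove p b₀ pb₀ with decideTrue (remove b₀ p)
...   | inj₂ none rewrite count-none (remove b₀ p) none = s≤s z≤n
...   | inj₁ (b₁ , kept₁) with remove⁻ p kept₁
...     | pb₁ , b₁≢b₀ with rank-schur b₀ b₁ (one pb₀ pb₁ (b₁≢b₀ ∘ sym)) K≤
...       | s′ , refl , K′≤ rewrite count-remove (remove b₀ p) b₁ kept₁ =
  -- The first pivot lies off the diagonal and removes two indices for one unit of rank; hence the
  -- `suc` in the bound.
  s≤s (s≤s (rank-identity (schur K b₀ b₁) (remove b₁ (remove b₀ p))
    (λ kept → diagonal kept)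
    (λ kept kept′ b≢b′ → trans (entry kept kept′)
      (cong (_xor true) (one (active kept) (active kept′) b≢b′)))
    K′≤))
  where
  active : ∀ {b} → remove b₁ (remove b₀ p) b ≡ true → p b ≡ true
  active kept = proj₁ (remove⁻ p (proj₁ (remove⁻ (remove b₀ p) kept)))

  entry : ∀ {b b′} → remove b₁ (remove b₀ p) b ≡ true → remove b₁ (remove b₀ p) b′ ≡ true →
    schur K b₀ b₁ b b′ ≡ K b b′ xor true
  entry {b} {b′} kept kept′
    rewrite one (active kept) pb₁ (proj₂ (remove⁻ (remove b₀ p) kept))
          | one pb₀ (active kept′)
              (proj₂ (remove⁻ p (proj₁ (remove⁻ (remove b₀ p) kept′))) ∘ sym) = refl

  diagonal : ∀ {b} → remove b₁ (remove b₀ p) b ≡ true → schur K b₀ b₁ b b ≡ true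
  diagonal {b} kept = trans (entry kept kept) (cong (_xor true) (zeroDiagonal b))

-- `T` plus its transpose has rank at most `t + t`, is zero on the diagonal, and is `J + I` on the
-- indices in `p`.
rank-tournament : ∀ {m} (T : Fin m → Fin m → Bool) (p : Fin m → Bool) →
  (∀ {b b′} → p b ≡ true → p b′ ≡ true → b ≢ b′ → T b b′ xor T b′ b ≡ true) →
  RankAtMost t T → count p ≤ suc (t + t)
rank-tournament T p tournament T≤ =
  rank-J+I (λ b b′ → T b b′ xor T b′ b) p (λ b → xor-same (T b b)) tournament
    (rank-xor T≤ (rank-transpose T≤))

-- Block matrices with tournaments on the diagonal

total : ∀ {N m} → (Fin N → Fin m → Bool) → ℕ
total {zero}  act = 0
total {suc N} act = count (act zero) + total (act ∘ suc)

total-all : ∀ N m → total {N} {m} (λ _ _ → true) ≡ N * m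
total-all zero    m = refl
total-all (suc N) m = cong₂ _+_ (count-all m) (total-all N m)

delete : ∀ {N m} → Fin N → Fin m → (Fin N → Fin m → Bool) → Fin N → Fin m → Bool
delete i b act = updateAt act i (remove b)

delete⁻ : ∀ {N m} (act : Fin N → Fin m → Bool) i {b a c} →
  delete i b act a c ≡ true → act a c ≡ true × (a ≡ i → c ≢ b)
delete⁻ act zero    {a = zero}  kept with ac , c≢b ← remove⁻ (act zero) kept = ac , λ _ → c≢b
delete⁻ act zero    {a = suc a} kept = kept , λ ()
delete⁻ act (suc i) {a = zero}  kept = kept , λ ()
delete⁻ act (suc i) {a = suc a} kept
  with ac , a≡i⇒ ← delete⁻ (act ∘ suc) i kept = ac , a≡i⇒ ∘ suc-injective

total-delete : ∀ {N m} (act : Fin N → Fin m → Bool) i b → act i b ≡ true →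
  total act ≡ suc (total (delete i b act))
total-delete act zero    b aib rewrite count-remove (act zero) b aib = refl
total-delete act (suc i) b aib rewrite total-delete (act ∘ suc) i b aib =
  +-suc (count (act zero)) _

-- act marks the indices that the elimination has not deleted yet.
record IsBlockMatrix {N m} (M : Fin N × Fin m → Fin N × Fin m → Bool)
                     (act : Fin N → Fin m → Bool) : Set where
  field
    diagonal   : ∀ {a a′ b b′} → act a b ≡ true → act a′ b′ ≡ true →
                 a′ < a → b ≢ b′ → M (a , b) (a′ , b′) ≡ false
    tournament : ∀ {a b b′} → act a b ≡ true → act a b′ ≡ true →
                 b ≢ b′ → M (a , b) (a , b′) xor M (a , b′) (a , b) ≡ true
open IsBlockMatrix

∧-true : ∀ {a b c} → a ≡ true → b ≡ true → (a ∧ b) ∧ c ≡ c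
∧-true refl refl = refl

-- Eliminating with the pivot in row (i + 1 , b) and column (0 , b) preserves the
-- block structure off the deleted indices because i is the last such row.
module Pivot {N m} {M : Fin (suc N) × Fin m → Fin (suc N) × Fin m → Bool}
  {act : Fin (suc N) → Fin m → Bool} (block : IsBlockMatrix M act) (i : Fin N) (b : Fin m)
  (aib : act (suc i) b ≡ true) (a0b : act zero b ≡ true)
  (last : ∀ j → i < j → (act (suc j) b ∧ act zero b) ∧ M (suc j , b) (zero , b) ≡ false)
  where

  act′ : Fin (suc N) → Fin m → Bool
  act′ = remove b (act zero) ∷ delete i b (act ∘ suc)

  M′ : Fin (suc N) × Fin m → Fin (suc N) × Fin m → Bool
  M′ = schur M (suc i , b) (zero , b)

  total-act : total act ≡ 2 + total act′
  total-act = trans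
    (cong₂ _+_ (count-remove (act zero) b a0b) (total-delete (act ∘ suc) i b aib))
    (cong suc (+-suc (count (remove b (act zero))) (total (delete i b (act ∘ suc)))))

  act′⁻ : ∀ a {c} → act′ a c ≡ true → act a c ≡ true
  act′⁻ zero    kept = proj₁ (remove⁻ (act zero) kept)
  act′⁻ (suc a) kept = proj₁ (delete⁻ (act ∘ suc) i kept)

  -- One factor always vanishes. For `a = 0` it is the second, below the block diagonal with
  -- `c′ ≢ b`. For `a > 0` the first vanishes if `c ≢ b`, and also if `c ≡ b` beyond the pivot row,
  -- by the choice of `i`. If `c ≡ b` before the pivot row, the second lies below the block diagonal
  -- with `c′ ≢ b`.
  noCorrection : ∀ {a a′ c c′} → act′ a c ≡ true → act′ a′ c′ ≡ true →
    a′ < a ⊎ a′ ≡ a → c ≢ c′ → M (a , c) (zero , b) ∧ M (suc i , b) (a′ , c′) ≡ false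
  noCorrection {zero} {zero} {c} {c′} ac ac′ _ c≢c′ =
    ∧-false (M (zero , c) (zero , b)) (diagonal block aib (act′⁻ zero ac′) (s≤s z≤n)
      (proj₂ (remove⁻ (act zero) ac′) ∘ sym))
  noCorrection {zero} {suc a′} ac ac′ (inj₁ ()) c≢c′
  noCorrection {zero} {suc a′} ac ac′ (inj₂ ()) c≢c′
  noCorrection {suc a} {a′} {c} {c′} ac ac′ a′≤a c≢c′ with c ≟ b
  ... | no c≢b = cong (_∧ M (suc i , b) (a′ , c′)) (diagonal block (act′⁻ (suc a) ac) a0b (s≤s z≤n) c≢b)
  ... | yes refl with <-cmp i a
  ...   | tri≈ _ refl _ = contradiction refl (proj₂ (delete⁻ (act ∘ suc) i ac) refl)
  ...   | tri< i<a _ _ = cong (_∧ M (suc i , b) (a′ , c′))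
            (trans (sym (∧-true (act′⁻ (suc a) ac) a0b)) (last a i<a))
  ...   | tri> _ _ a<i = ∧-false (M (suc a , b) (zero , b))
            (diagonal block aib (act′⁻ a′ ac′) (below a′≤a) c≢c′)
    where
    below : a′ < suc a ⊎ a′ ≡ suc a → a′ < suc i
    below (inj₁ a′<a) = <-trans a′<a (s≤s a<i)
    below (inj₂ refl) = s≤s a<i

  block′ : IsBlockMatrix M′ act′
  block′ .diagonal {a} {a′} {c} {c′} ac ac′ a′<a c≢c′ =
    trans (corrected (M (a , c) (zero , b)) _ (noCorrection {a} ac ac′ (inj₁ a′<a) c≢c′))
      (diagonal block (act′⁻ a ac) (act′⁻ a′ ac′) a′<a c≢c′)
  block′ .tournament {a} {c} {c′} ac ac′ c≢c′ = trans
    (cong₂ _xor_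
      (corrected {M (a , c) (a , c′)} (M (a , c) (zero , b)) _ (noCorrection {a} {a} ac ac′ (inj₂ refl) c≢c′))
      (corrected {M (a , c′) (a , c)} (M (a , c′) (zero , b)) _ (noCorrection {a} {a} ac′ ac (inj₂ refl) (c≢c′ ∘ sym))))
    (tournament block (act′⁻ a ac) (act′⁻ a ac′) c≢c′)

module Split {N m} {M : Fin (suc N) × Fin m → Fin (suc N) × Fin m → Bool}
  {act : Fin (suc N) → Fin m → Bool} (block : IsBlockMatrix M act)
  (none : ∀ b a → (act (suc a) b ∧ act zero b) ∧ M (suc a , b) (zero , b) ≡ false)
  where

  mask : Fin (suc N) × Fin m → Bool
  mask (a , b) = act a b

  -- Deleted indices are zeroed because `rank-split` asks for a block that vanishes entirely, while
  -- `none` and `block` speak of active indices.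
  M̂ : Fin (suc N) × Fin m → Fin (suc N) × Fin m → Bool
  M̂ x y = (mask x ∧ mask y) ∧ M x y

  tail : Fin N × Fin m → Fin (suc N) × Fin m
  tail (a , b) = suc a , b

  decoupled : ∀ x b′ → M̂ (tail x) (zero , b′) ≡ false
  decoupled (a , b) b′ with b ≟ b′ | act (suc a) b in ab | act zero b′ in a0b′
  ... | _ | false | _ = refl
  ... | _ | true | false = refl
  ... | no b≢b′ | true | true = diagonal block ab a0b′ (s≤s z≤n) b≢b′
  ... | yes refl | true | true = trans (sym (∧-true ab a0b′)) (none b a)

  block′ : IsBlockMatrix (λ x y → M̂ (tail x) (tail y)) (act ∘ suc)
  block′ .diagonal ab ab′ a′<a b≢b′ =
    trans (∧-true ab ab′) (diagonal block ab ab′ (s≤s a′<a) b≢b′)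
  block′ .tournament ab ab′ b≢b′ =
    trans (cong₂ _xor_ (∧-true ab ab′) (∧-true ab′ ab)) (tournament block ab ab′ b≢b′)

  headTournament : ∀ {b b′} → act zero b ≡ true → act zero b′ ≡ true → b ≢ b′ →
    M̂ (zero , b) (zero , b′) xor M̂ (zero , b′) (zero , b) ≡ true
  headTournament ab ab′ b≢b′ =
    trans (cong₂ _xor_ (∧-true ab ab′) (∧-true ab′ ab)) (tournament block ab ab′ b≢b′)

∧-true⁻ : ∀ {x y z} → (x ∧ y) ∧ z ≡ true → x ≡ true × y ≡ true × z ≡ true
∧-true⁻ {true} {true} {true} _ = refl , refl , refl

-- The bound that `rank-tournament` would give block by block; `N` collects one unit from each
-- diagonal tournament.
BlockBound : ℕ → ℕ → Set
BlockBound N m = ∀ s {M : Fin N × Fin m → Fin N × Fin m → Bool} {act} →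
  IsBlockMatrix M act → RankAtMost s M → total act ≤ (s + s) + N

-- A nonzero active entry below the diagonal in block column 0 serves as pivot: two indices and one
-- unit of rank disappear, so both sides drop by two. Without such an entry block 0 splits off and
-- the other `N` blocks fall to `ih`.
blockBound-suc : ∀ {N m} → BlockBound N m → BlockBound (suc N) m
blockBound-suc {N} ih s {M} {act} block M≤
  with search (λ b → lastTrue (λ i → (act (suc i) b ∧ act zero b) ∧ M (suc i , b) (zero , b)))
blockBound-suc {N} ih s {M} {act} block M≤ | inj₂ none
  with rank-split M̂ tail tail (zero ,_) (zero ,_) decoupled (rank-mask mask mask M≤)
  where open Split block none
... | t₁ , t₀ , refl , T≤ , M₀≤ = ≤-trans
    (+-mono-≤ (rank-tournament _ (act zero) (Split.headTournament block none) T≤)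
      (ih t₀ (Split.block′ block none) M₀≤))
    (≤-reflexive (regroup t₁ t₀ N))
blockBound-suc {N} ih s {M} {act} block M≤ | inj₁ (b , i , found , last)
  with aib , a0b , pivot ← ∧-true⁻ {act (suc i) b} found
  with rank-schur (suc i , b) (zero , b) pivot M≤
blockBound-suc {N} ih (suc s) {M} {act} block M≤ | inj₁ (b , i , found , last) | .s , refl , M′≤ =
  ≤-trans (≤-reflexive total-act)
    (≤-trans (s≤s (s≤s (blockBound-suc ih s block′ M′≤)))
      (≤-reflexive (cong (λ x → suc (x + suc N)) (sym (+-suc s s)))))
  where open Pivot block i b aib a0b last

rank-blocks : ∀ N m → BlockBound N m
rank-blocks zero    m s block M≤ = z≤n
rank-blocks (suc N) m = blockBound-suc (rank-blocks N m)

-- Functions of two pairs in a single coordinate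

xor-cancel : ∀ {x y} → x xor y ≡ false → x ≡ y
xor-cancel {false} {false} _ = refl
xor-cancel {true}  {true}  _ = refl

Disjoint : Pair n → Pair n → Set
Disjoint u v = ∀ x → x ∈₂ u → x ∈₂ v → ⊥

Disjoint-sym : (u v : Pair n) → Disjoint u v → Disjoint v u
Disjoint-sym u v u∩v x x∈v x∈u = u∩v x x∈u x∈v

infix 4 _≐_⊕_
_≐_⊕_ : Pair n → Pair n → Pair n → Set
u ≐ v ⊕ w = ∀ x → (x ∈₂? u) ≡ (x ∈₂? v) xor (x ∈₂? w)

-- The dependence of a form on one coordinate when the others are fixed or summed out. Additivity is
-- recorded on each side, as such a function may fail to be symmetric.
record IsIntersectionLike (G : Pair n → Pair n → Bool) : Set where
  field
    addˡ   : ∀ {u v w} → u ≐ v ⊕ w → ∀ t → G u t ≡ G v t xor G w t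
    addʳ   : ∀ {u v w} → u ≐ v ⊕ w → ∀ t → G t u ≡ G t v xor G t w
    vanish : ∀ u v → Disjoint u v → G u v ≡ false

flip-intersectionLike : {G : Pair n → Pair n → Bool} → IsIntersectionLike G → IsIntersectionLike (flip G)
flip-intersectionLike isG = record
  { addˡ = addʳ ; addʳ = addˡ ; vanish = λ u v u∩v → vanish v u (Disjoint-sym u v u∩v) }
  where open IsIntersectionLike isG

star : Fin (suc n) → Pair (suc (suc n))
star b = ⟨ zero , suc b ∣ s≤s z≤n ⟩

chord : {c d : Fin (suc n)} → c < d → Pair (suc (suc n))
chord {c = c} {d} c<d = ⟨ suc c , suc d ∣ s≤s c<d ⟩

chord≐star⊕star : {c d : Fin (suc n)} (c<d : c < d) → chord c<d ≐ star c ⊕ star d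
chord≐star⊕star c<d zero = refl
chord≐star⊕star {c = c} {d} c<d (suc x) with x ≟ c | x ≟ d
... | yes refl | yes refl = contradiction refl (<⇒≢ c<d)
... | yes _    | no _     = refl
... | no _     | yes _    = refl
... | no _     | no _     = refl

star-chord-disjoint : {b c d : Fin (suc n)} (c<d : c < d) → b ≢ c → b ≢ d → Disjoint (star b) (chord c<d)
star-chord-disjoint c<d b≢c b≢d _ (inj₁ refl) (inj₁ ())
star-chord-disjoint c<d b≢c b≢d _ (inj₁ refl) (inj₂ ())
star-chord-disjoint c<d b≢c b≢d _ (inj₂ refl) (inj₁ eq) = b≢c (suc-injective eq)
star-chord-disjoint c<d b≢c b≢d _ (inj₂ refl) (inj₂ eq) = b≢d (suc-injective eq)

-- With vertices counted from 1, `star (suc a)` and `spoke a` are the pairs p and q at the vertex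
-- `a + 3`.
spoke : Fin n → Pair (suc (suc n))
spoke a = ⟨ suc zero , suc (suc a) ∣ s≤s (s≤s z≤n) ⟩

spoke≐star⊕star : (a : Fin (suc n)) → spoke a ≐ star zero ⊕ star (suc a)
spoke≐star⊕star a = chord≐star⊕star (s≤s z≤n)

star-spoke-disjoint : {a a′ : Fin n} → a ≢ a′ → Disjoint (star (suc a)) (spoke a′)
star-spoke-disjoint a≢a′ _ (inj₁ refl) (inj₁ ())
star-spoke-disjoint a≢a′ _ (inj₁ refl) (inj₂ ())
star-spoke-disjoint a≢a′ _ (inj₂ refl) (inj₁ ())
star-spoke-disjoint a≢a′ _ (inj₂ refl) (inj₂ refl) = a≢a′ refl

-- The shapes of two pairs with one common vertex that occur: `stars` in the first coordinate of M
-- and in the normalisation sum, `star-spoke` in the other coordinates of a diagonal block.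
data Crossing {n} : Pair (suc (suc n)) → Pair (suc (suc n)) → Set where
  stars      : ∀ {b c} → b ≢ c → Crossing (star b) (star c)
  star-spoke : ∀ a → Crossing (star (suc a)) (spoke a)

avoid₂ : (b b′ : Fin (suc (suc (suc n)))) → ∃ λ d → b ≢ d × b′ ≢ d
avoid₂ zero          zero          = suc zero , (λ ()) , λ ()
avoid₂ zero          (suc zero)    = suc (suc zero) , (λ ()) , λ ()
avoid₂ zero          (suc (suc _)) = suc zero , (λ ()) , λ ()
avoid₂ (suc zero)    zero          = suc (suc zero) , (λ ()) , λ ()
avoid₂ (suc (suc _)) zero          = suc zero , (λ ()) , λ ()
avoid₂ (suc _)       (suc _)       = zero , (λ ()) , λ ()

-- The chord joining `c` and `d` is the sum of their stars and is disjoint from `star b`, so the two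
-- values add up to zero.
star-moveʳ : {G : Pair (suc (suc n)) → Pair (suc (suc n)) → Bool} → IsIntersectionLike G →
  ∀ {b c d} → b ≢ c → b ≢ d → G (star b) (star c) ≡ G (star b) (star d)
star-moveʳ {G = G} isG {b} {c} {d} b≢c b≢d with <-cmp c d
... | tri≈ _ refl _ = refl
... | tri< c<d _ _ = xor-cancel
  (trans (sym (addʳ (chord≐star⊕star c<d) (star b))) (vanish (star b) (chord c<d) (star-chord-disjoint c<d b≢c b≢d)))
  where open IsIntersectionLike isG
... | tri> _ _ d<c = sym (xor-cancel
  (trans (sym (addʳ (chord≐star⊕star d<c) (star b))) (vanish (star b) (chord d<c) (star-chord-disjoint d<c b≢d b≢c))))
  where open IsIntersectionLike isG

module _ {G : Pair (4 + n) → Pair (4 + n) → Bool} (isG : IsIntersectionLike G) where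
  open IsIntersectionLike isG

  star-constant : ∀ {b c b′ c′} → b ≢ c → b′ ≢ c′ → G (star b) (star c) ≡ G (star b′) (star c′)
  star-constant {b} {c} {b′} {c′} b≢c b′≢c′ with avoid₂ b b′
  ... | d , b≢d , b′≢d =
    -- The route is `(b , c)`, `(b , d)`, `(b′ , d)`, `(b′ , c′)`; a third star `d` exists because
    -- there are at least four vertices.
    trans (star-moveʳ isG b≢c b≢d)
      (trans (star-moveʳ (flip-intersectionLike isG) (b≢d ∘ sym) (b′≢d ∘ sym))
        (star-moveʳ isG b′≢d b′≢c′))

  -- For a star and its spoke, expanding the spoke gives both sides the same square term, leaving
  -- only values on distinct stars.
  crossing-symmetric : ∀ {p q} → Crossing p q → G p q ≡ G q p
  crossing-symmetric (stars b≢c) = star-constant b≢c (b≢c ∘ sym)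
  crossing-symmetric (star-spoke a) = begin
    G (star (suc a)) (spoke a)
      ≡⟨ addʳ (spoke≐star⊕star a) (star (suc a)) ⟩
    G (star (suc a)) (star zero) xor G (star (suc a)) (star (suc a))
      ≡⟨ cong (_xor G (star (suc a)) (star (suc a))) (star-constant (λ ()) (λ ())) ⟩
    G (star zero) (star (suc a)) xor G (star (suc a)) (star (suc a))
      ≡⟨ sym (addˡ (spoke≐star⊕star a) (star (suc a))) ⟩
    G (spoke a) (star (suc a)) ∎
    where open ≡-Reasoning

  crossing-standard : (∀ u → G u u ≡ false) → ∀ {p q} → Crossing p q →
    G p q ≡ G (star zero) (star (suc zero))
  crossing-standard alternating (stars b≢c) = star-constant b≢c (λ ())
  crossing-standard alternating (star-spoke a) = begin
    G (star (suc a)) (spoke a)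
      ≡⟨ addʳ (spoke≐star⊕star a) (star (suc a)) ⟩
    G (star (suc a)) (star zero) xor G (star (suc a)) (star (suc a))
      ≡⟨ cong₂ _xor_ (star-constant (λ ()) (λ ())) (alternating (star (suc a))) ⟩
    G (star zero) (star (suc zero)) xor false
      ≡⟨ xor-identityʳ _ ⟩
    G (star zero) (star (suc zero)) ∎
    where open ≡-Reasoning

-- Forms on tuples of pairs, their slices and twists

Form : ℕ → ℕ → Set
Form n m = (Fin m → Pair n) → (Fin m → Pair n) → Bool

hasFace : (Fin m → Pair n) → (Fin m → Fin n) → Bool
hasFace {m} P f = andAll m (λ i → f i ∈₂? P i)

-- Tuples are functions, so invariance under pointwise equality is a separate field.
record IsForm {n m} (B : Form n m) : Set where
  field
    respects : ∀ {P P′ Q Q′} → P ≗ P′ → Q ≗ Q′ → B P Q ≡ B P′ Q′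
    addˡ : ∀ {P P₁ P₂} → (∀ f → hasFace P f ≡ hasFace P₁ f xor hasFace P₂ f) →
           ∀ Q → B P Q ≡ B P₁ Q xor B P₂ Q
    addʳ : ∀ {P P₁ P₂} → (∀ f → hasFace P f ≡ hasFace P₁ f xor hasFace P₂ f) →
           ∀ Q → B Q P ≡ B Q P₁ xor B Q P₂

Vanishing Symmetric Alternating : Form n m → Set
Vanishing   B = ∀ P Q → (∀ i → Disjoint (P i) (Q i)) → B P Q ≡ false
Symmetric   B = ∀ P Q → B P Q ≡ B Q P
Alternating B = ∀ P → B P P ≡ false

infixl 6 _⊞_
_⊞_ : Form n m → Form n m → Form n m
(B ⊞ C) P Q = B P Q xor C P Q

slice : Form n (suc m) → Pair n → Pair n → Form n m
slice B u v P Q = B (u ∷ P) (v ∷ Q)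

twist : Form n (suc m) → (p q p′ q′ : Pair n) → Form n m
twist B p q p′ q′ = slice B p q′ ⊞ slice B q p′

∷-cong : ∀ {A : Set} {u : A} {P P′ : Fin m → A} → P ≗ P′ → (u ∷ P) ≗ (u ∷ P′)
∷-cong eq zero    = refl
∷-cong eq (suc i) = eq i

xor-middle : ∀ a b c d → (a xor b) xor (c xor d) ≡ (a xor c) xor (b xor d)
xor-middle = solve 4 (λ a b c d → (a :+ b) :+ (c :+ d) := (a :+ c) :+ (b :+ d)) refl

⊞-isForm : {B C : Form n m} → IsForm B → IsForm C → IsForm (B ⊞ C)
⊞-isForm {B = B} {C} isB isC = record
  { respects = λ P≗ Q≗ → cong₂ _xor_ (B.respects P≗ Q≗) (C.respects P≗ Q≗)
  ; addˡ = λ faces Q → trans (cong₂ _xor_ (B.addˡ faces Q) (C.addˡ faces Q)) (xor-middle (B _ Q) _ (C _ Q) _)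
  ; addʳ = λ faces Q → trans (cong₂ _xor_ (B.addʳ faces Q) (C.addʳ faces Q)) (xor-middle (B Q _) _ (C Q _) _)
  }
  where
  module B = IsForm isB
  module C = IsForm isC

slice-isForm : {B : Form n (suc m)} → IsForm B → ∀ u v → IsForm (slice B u v)
slice-isForm isB u v = record
  { respects = λ P≗ Q≗ → respects (∷-cong P≗) (∷-cong Q≗)
  ; addˡ = λ {P} {P₁} {P₂} faces Q → addˡ {u ∷ P} {u ∷ P₁} {u ∷ P₂} (cone u {P} {P₁} {P₂} faces) (v ∷ Q)
  ; addʳ = λ {P} {P₁} {P₂} faces Q → addʳ {v ∷ P} {v ∷ P₁} {v ∷ P₂} (cone v {P} {P₁} {P₂} faces) (u ∷ Q)
  }
  where
  open IsForm isB
  cone : ∀ u {P P₁ P₂ : Fin _ → Pair _} → (∀ f → hasFace P f ≡ hasFace P₁ f xor hasFace P₂ f) →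
    ∀ f → hasFace (u ∷ P) f ≡ hasFace (u ∷ P₁) f xor hasFace (u ∷ P₂) f
  cone u faces f = trans (cong ((f zero ∈₂? u) ∧_) (faces (f ∘ suc)))
    (∧-distribˡ-xor (f zero ∈₂? u) _ _)

twist-isForm : {B : Form n (suc m)} → IsForm B → ∀ p q p′ q′ → IsForm (twist B p q p′ q′)
twist-isForm isB p q p′ q′ = ⊞-isForm (slice-isForm isB p q′) (slice-isForm isB q p′)

hasFace-head : ∀ {u v w : Pair n} → u ≐ v ⊕ w → (P : Fin m → Pair n) → ∀ f →
  hasFace (u ∷ P) f ≡ hasFace (v ∷ P) f xor hasFace (w ∷ P) f
hasFace-head {v = v} {w} u≐ P f = trans (cong (_∧ hasFace P (f ∘ suc)) (u≐ (f zero)))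
  (∧-distribʳ-xor (hasFace P (f ∘ suc)) (f zero ∈₂? v) (f zero ∈₂? w))

slice-addˡ : ∀ {B : Form n (suc m)} → IsForm B → ∀ {u v w} → u ≐ v ⊕ w → ∀ t P Q →
  slice B u t P Q ≡ slice B v t P Q xor slice B w t P Q
slice-addˡ isB {u} {v} {w} u≐ t P Q =
  IsForm.addˡ isB {u ∷ P} {v ∷ P} {w ∷ P} (hasFace-head {u = u} {v} {w} u≐ P) (t ∷ Q)

slice-addʳ : ∀ {B : Form n (suc m)} → IsForm B → ∀ {u v w} → u ≐ v ⊕ w → ∀ t P Q →
  slice B t u P Q ≡ slice B t v P Q xor slice B t w P Q
slice-addʳ isB {u} {v} {w} u≐ t P Q =
  IsForm.addʳ isB {u ∷ Q} {v ∷ Q} {w ∷ Q} (hasFace-head {u = u} {v} {w} u≐ Q) (t ∷ P)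

slice-intersectionLike : {B : Form n (suc m)} → IsForm B → Vanishing B →
  ∀ P Q → (∀ i → Disjoint (P i) (Q i)) → IsIntersectionLike (λ u v → slice B u v P Q)
slice-intersectionLike isB vanishing P Q P∩Q = record
  { addˡ = λ u≐ t → slice-addˡ isB u≐ t P Q
  ; addʳ = λ u≐ t → slice-addʳ isB u≐ t P Q
  ; vanish = λ u v u∩v → vanishing (u ∷ P) (v ∷ Q) λ { zero → u∩v ; (suc i) → P∩Q i }
  }

slice-vanishing : {B : Form n (suc m)} → Vanishing B → ∀ {u v} → Disjoint u v → Vanishing (slice B u v)
slice-vanishing vanishing u∩v P Q P∩Q = vanishing _ _ λ { zero → u∩v ; (suc i) → P∩Q i }

twist-vanishing-disjoint : {B : Form n (suc m)} → Vanishing B → ∀ {p q p′ q′} →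
  Disjoint p q′ → Disjoint q p′ → Vanishing (twist B p q p′ q′)
twist-vanishing-disjoint vanishing p∩q′ q∩p′ P Q P∩Q =
  cong₂ _xor_ (slice-vanishing vanishing p∩q′ P Q P∩Q) (slice-vanishing vanishing q∩p′ P Q P∩Q)

-- Once the other coordinates are disjoint, the first one is intersection-like, hence symmetric on
-- crossing pairs, and the two summands cancel.
twist-vanishing : {B : Form (4 + n) (suc m)} → IsForm B → Vanishing B → ∀ {p q} → Crossing p q →
  Vanishing (twist B p q p q)
twist-vanishing {B = B} isB vanishing {p} {q} cross P Q P∩Q = trans
  (cong (_xor slice B q p P Q) (crossing-symmetric (slice-intersectionLike isB vanishing P Q P∩Q) cross))
  (xor-same (slice B q p P Q))

twist-symmetric : {B : Form n (suc m)} → Symmetric B → ∀ p q → Symmetric (twist B p q p q)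
twist-symmetric {B = B} symB p q P Q = trans
  (cong₂ _xor_ (symB (p ∷ P) (q ∷ Q)) (symB (q ∷ P) (p ∷ Q)))
  (xor-comm (B (q ∷ Q) (p ∷ P)) _)

twist-alternating : {B : Form n (suc m)} → Symmetric B → ∀ p q → Alternating (twist B p q p q)
twist-alternating {B = B} symB p q P =
  trans (cong (_xor B (q ∷ P) (p ∷ P)) (symB (p ∷ P) (q ∷ P))) (xor-same (B (q ∷ P) (p ∷ P)))

-- Half sums and their independence of the crossing pair

-- The sum of B over all ways of giving one of p , q (respectively the opposite
-- one of p′ , q′) to each coordinate but the last, where p and q′ are kept.
halfSum : ∀ m → Form n (suc m) → (p q p′ q′ : Pair n) → Bool
halfSum zero    B p q p′ q′ = B (p ∷ λ ()) (q′ ∷ λ ())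
halfSum (suc m) B p q p′ q′ = halfSum m (twist B p q p′ q′) p q p′ q′

halfSum-cong : ∀ m {B C : Form n (suc m)} {p q p′ q′} → (∀ P Q → B P Q ≡ C P Q) →
  halfSum m B p q p′ q′ ≡ halfSum m C p q p′ q′
halfSum-cong zero    B≡C = B≡C _ _
halfSum-cong (suc m) B≡C = halfSum-cong m λ P Q → cong₂ _xor_ (B≡C _ _) (B≡C _ _)

halfSum-⊞ : ∀ m {B C : Form n (suc m)} {p q p′ q′} →
  halfSum m (B ⊞ C) p q p′ q′ ≡ halfSum m B p q p′ q′ xor halfSum m C p q p′ q′
halfSum-⊞ zero = refl
halfSum-⊞ (suc m) {B} {C} {p} {q} {p′} {q′} = trans
  (halfSum-cong m λ P Q → xor-middle (B (p ∷ P) (q′ ∷ Q)) _ (B (q ∷ P) (p′ ∷ Q)) _)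
  (halfSum-⊞ m)

halfSum-zero : ∀ m {B : Form n (suc m)} {p q p′ q′} → (∀ P Q → B P Q ≡ false) →
  halfSum m B p q p′ q′ ≡ false
halfSum-zero zero    B≡0 = B≡0 _ _
halfSum-zero (suc m) B≡0 = halfSum-zero m λ P Q → cong₂ _xor_ (B≡0 _ _) (B≡0 _ _)

halfSum-disjoint : ∀ m {B : Form n (suc m)} → Vanishing B → ∀ {p q p′ q′} →
  Disjoint p q′ → Disjoint q p′ → halfSum m B p q p′ q′ ≡ false
halfSum-disjoint zero    vanishing p∩q′ q∩p′ = vanishing _ _ λ { zero → p∩q′ }
halfSum-disjoint (suc m) vanishing p∩q′ q∩p′ =
  halfSum-disjoint m (twist-vanishing-disjoint vanishing p∩q′ q∩p′) p∩q′ q∩p′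

-- Symmetrising commutes with twisting, so the sum reduces to one coordinate, where
-- `twist-vanishing` applies.
halfSum-symmetrised : ∀ m {B : Form (4 + n) (suc m)} → IsForm B → Vanishing B →
  ∀ {p q} → Crossing p q → halfSum m (B ⊞ flip B) p q p q ≡ false
halfSum-symmetrised zero {B} isB vanishing {p} {q} cross =
  trans (cong (B (p ∷ λ ()) (q ∷ λ ()) xor_) (respects refl∷ refl∷))
    (twist-vanishing isB vanishing cross (λ ()) (λ ()) (λ ()))
  where
  open IsForm isB
  refl∷ : ∀ {A : Set} {u : A} {P Q : Fin 0 → A} → (u ∷ P) ≗ (u ∷ Q)
  refl∷ zero = refl
halfSum-symmetrised (suc m) {B} isB vanishing {p} {q} cross = trans
  (halfSum-cong m λ P Q →
    solve 4 (λ a b c d → (a :+ b) :+ (c :+ d) := (a :+ c) :+ (d :+ b)) refl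
      (B (p ∷ P) (q ∷ Q)) (B (q ∷ Q) (p ∷ P)) (B (q ∷ P) (p ∷ Q)) (B (p ∷ Q) (q ∷ P)))
  (halfSum-symmetrised m (twist-isForm isB p q p q) (twist-vanishing isB vanishing cross) cross)

halfSum-slice-intersectionLike : ∀ m {B : Form n (suc (suc m))} → IsForm B → Vanishing B →
  ∀ {p q p′ q′} → Disjoint p q′ → Disjoint q p′ →
  IsIntersectionLike (λ u v → halfSum m (slice B u v) p q p′ q′)
halfSum-slice-intersectionLike m isB vanishing p∩q′ q∩p′ = record
  { addˡ = λ u≐ t → trans (halfSum-cong m (slice-addˡ isB u≐ t)) (halfSum-⊞ m)
  ; addʳ = λ u≐ t → trans (halfSum-cong m (slice-addʳ isB u≐ t)) (halfSum-⊞ m)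
  ; vanish = λ u v u∩v → halfSum-disjoint m (slice-vanishing vanishing u∩v) p∩q′ q∩p′
  }

-- For disjoint `u` and `v`, symmetry of `B` rewrites the twist as a slice plus its own flip, which
-- `halfSum-symmetrised` annihilates.
halfSum-twist-intersectionLike : ∀ m {B : Form (4 + n) (suc (suc m))} →
  IsForm B → Symmetric B → Vanishing B → ∀ {p q} → Crossing p q →
  IsIntersectionLike (λ u v → halfSum m (twist B u v u v) p q p q)
halfSum-twist-intersectionLike m {B} isB symB vanishing cross = record
  { addˡ = λ {u} {v} {w} u≐ t → trans
      (halfSum-cong m λ P Q → trans
        (cong₂ _xor_ (slice-addˡ isB u≐ t P Q) (slice-addʳ isB u≐ t P Q))
        (xor-middle (slice B v t P Q) _ (slice B t v P Q) _))
      (halfSum-⊞ m)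
  ; addʳ = λ {u} {v} {w} u≐ t → trans
      (halfSum-cong m λ P Q → trans
        (cong₂ _xor_ (slice-addʳ isB u≐ t P Q) (slice-addˡ isB u≐ t P Q))
        (xor-middle (slice B t v P Q) _ (slice B v t P Q) _))
      (halfSum-⊞ m)
  ; vanish = λ u v u∩v → trans
      (halfSum-cong m λ P Q → cong (slice B u v P Q xor_) (symB (v ∷ P) (u ∷ Q)))
      (halfSum-symmetrised m (slice-isForm isB u v) (slice-vanishing vanishing u∩v) cross)
  }

halfSum-twist-standard : ∀ m {B : Form (4 + n) (suc (suc m))} →
  IsForm B → Symmetric B → Vanishing B → ∀ {p q u v} → Crossing p q → Crossing u v →
  halfSum m (twist B u v u v) p q p q ≡
  halfSum m (twist B (star zero) (star (suc zero)) (star zero) (star (suc zero))) p q p q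
halfSum-twist-standard m {B} isB symB vanishing cross =
  crossing-standard (halfSum-twist-intersectionLike m isB symB vanishing cross)
    (λ u → halfSum-zero m λ P Q → xor-same (slice B u u P Q))

-- The twisted form inherits all hypotheses, so induction standardises the later coordinates;
-- `halfSum-twist-standard` then treats the first.
halfSum-standard : ∀ m {B : Form (4 + n) (suc m)} →
  IsForm B → Symmetric B → Alternating B → Vanishing B → ∀ {p q} → Crossing p q →
  halfSum m B p q p q ≡ halfSum m B (star zero) (star (suc zero)) (star zero) (star (suc zero))
halfSum-standard zero {B} isB symB altB vanishing cross =
  trans (respects (λ { zero → refl }) (λ { zero → refl }))
    (trans (crossing-standard
      (slice-intersectionLike isB vanishing (λ ()) (λ ()) (λ ()))
      (λ u → altB (u ∷ λ ())) cross)
    (respects (λ { zero → refl }) (λ { zero → refl })))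
  where open IsForm isB
halfSum-standard (suc m) {B} isB symB altB vanishing {p} {q} cross = trans
  (halfSum-standard m (twist-isForm isB p q p q) (twist-symmetric symB p q)
    (twist-alternating symB p q) (twist-vanishing isB vanishing cross) cross)
  (halfSum-twist-standard m isB symB vanishing (stars (λ ())) cross)

-- Full sums and the shape of the normalisation sum

fullSum : ∀ m → Form n m → (p q : Pair n) → Bool
fullSum zero    B p q = B (λ ()) (λ ())
fullSum (suc m) B p q = fullSum m (twist B p q p q) p q

fullSum-cong : ∀ m {B C : Form n m} {p q} → (∀ P Q → B P Q ≡ C P Q) → fullSum m B p q ≡ fullSum m C p q
fullSum-cong zero    B≡C = B≡C _ _
fullSum-cong (suc m) B≡C = fullSum-cong m λ P Q → cong₂ _xor_ (B≡C _ _) (B≡C _ _)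

fullSum-⊞ : ∀ m {B C : Form n m} {p q} → fullSum m (B ⊞ C) p q ≡ fullSum m B p q xor fullSum m C p q
fullSum-⊞ zero = refl
fullSum-⊞ (suc m) {B} {C} {p} {q} = trans
  (fullSum-cong m λ P Q → xor-middle (B (p ∷ P) (q ∷ Q)) _ (B (q ∷ P) (p ∷ Q)) _)
  (fullSum-⊞ m)

fullSum-flip : ∀ m {B : Form n m} {p q} → IsForm B → fullSum m (flip B) p q ≡ fullSum m B p q
fullSum-flip zero isB = IsForm.respects isB (λ ()) (λ ())
fullSum-flip (suc m) {B} {p} {q} isB = trans
  (fullSum-cong m λ P Q → xor-comm (B (q ∷ Q) (p ∷ P)) _)
  (fullSum-flip m (twist-isForm isB p q p q))

-- Fixing the choice in the last coordinate or in the first one gives the same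
-- sum, since complementing all choices transposes the entry of B.
halfSum≡fullSum-slice : ∀ m {B : Form n (suc m)} → IsForm B → Symmetric B → ∀ p q →
  halfSum m B p q p q ≡ fullSum m (slice B p q) p q
halfSum≡fullSum-slice zero isB symB p q =
  IsForm.respects isB (λ { zero → refl }) (λ { zero → refl })
halfSum≡fullSum-slice (suc m) {B} isB symB p q = begin
  halfSum m (twist B p q p q) p q p q
    ≡⟨ halfSum≡fullSum-slice m (twist-isForm isB p q p q) (twist-symmetric symB p q) p q ⟩
  fullSum m (slice (twist B p q p q) p q) p q
    ≡⟨ fullSum-⊞ m {slice (slice B p q) p q} {slice (slice B q p) p q} ⟩
  fullSum m (slice (slice B p q) p q) p q xor fullSum m (slice (slice B q p) p q) p q
    ≡⟨ cong (fullSum m (slice (slice B p q) p q) p q xor_) (trans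
         (fullSum-cong m (λ P Q → symB (q ∷ p ∷ P) (p ∷ q ∷ Q)))
         (fullSum-flip m {slice (slice B p q) q p} (slice-isForm (slice-isForm isB p q) q p))) ⟩
  fullSum m (slice (slice B p q) p q) p q xor fullSum m (slice (slice B p q) q p) p q
    ≡⟨ sym (fullSum-⊞ m {slice (slice B p q) p q} {slice (slice B p q) q p}) ⟩
  fullSum m (twist (slice B p q) p q p q) p q ∎
  where open ≡-Reasoning

xorSumFun-cong : ∀ m {F F′ : (Fin m → Bool) → Bool} → (∀ t → F t ≡ F′ t) → xorSumFun m F ≡ xorSumFun m F′
xorSumFun-cong zero    eq = eq _
xorSumFun-cong (suc m) eq = cong₂ _xor_ (xorSumFun-cong m λ t → eq _) (xorSumFun-cong m λ t → eq _)

xorSumFun-xor : ∀ m (F F′ : (Fin m → Bool) → Bool) →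
  xorSumFun m (λ t → F t xor F′ t) ≡ xorSumFun m F xor xorSumFun m F′
xorSumFun-xor zero    F F′ = refl
xorSumFun-xor (suc m) F F′ = trans
  (cong₂ _xor_ (xorSumFun-xor m _ _) (xorSumFun-xor m _ _))
  (xor-middle (xorSumFun m (λ t → F (false ∷ t))) _ (xorSumFun m (λ t → F (true ∷ t))) _)

select : ∀ {A : Set} → A → A → (Fin m → Bool) → Fin m → A
select p q t i = if t i then q else p

xorSumFun≡fullSum : ∀ m {B : Form n m} → IsForm B → ∀ p q →
  xorSumFun m (λ t → B (select p q t) (select p q (not ∘ t))) ≡ fullSum m B p q
xorSumFun≡fullSum zero    isB p q = IsForm.respects isB (λ ()) (λ ())
xorSumFun≡fullSum (suc m) {B} isB p q = trans
  (cong₂ _xor_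
    (xorSumFun-cong m λ t → respects (λ { zero → refl ; (suc i) → refl }) (λ { zero → refl ; (suc i) → refl }))
    (xorSumFun-cong m λ t → respects (λ { zero → refl ; (suc i) → refl }) (λ { zero → refl ; (suc i) → refl })))
  (trans (sym (xorSumFun-xor m _ _))
    (xorSumFun≡fullSum m (twist-isForm isB p q p q) p q))
  where open IsForm isB

-- The sum has `2 ^ m` terms, each of rank at most `r`. `B` may vary with `x` and `y` because a
-- twist inserts pairs that depend on them.
rank-halfSum : ∀ m (B : X → Y → Form n (suc m)) (p q : X → Pair n) (p′ q′ : Y → Pair n) {r} →
  (∀ (φ : X → Fin (suc m) → Pair n) (ψ : Y → Fin (suc m) → Pair n) → RankAtMost r (λ x y → B x y (φ x) (ψ y))) →
  RankAtMost (2 ^ m * r) (λ x y → halfSum m (B x y) (p x) (q x) (p′ y) (q′ y))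
rank-halfSum zero B p q p′ q′ {r} B≤ rewrite +-identityʳ r = B≤ (λ x → p x ∷ λ ()) (λ y → q′ y ∷ λ ())
rank-halfSum (suc m) B p q p′ q′ {r} B≤ = subst
  (λ s → RankAtMost s (λ x y → halfSum (suc m) (B x y) (p x) (q x) (p′ y) (q′ y)))
  (double (2 ^ m) r)
  (rank-halfSum m (λ x y → twist (B x y) (p x) (q x) (p′ y) (q′ y)) p q p′ q′ λ φ ψ →
    rank-xor (B≤ (λ x → p x ∷ φ x) (λ y → q′ y ∷ ψ y)) (B≤ (λ x → q x ∷ φ x) (λ y → p′ y ∷ ψ y)))

-- Decomposing pairs and enumerating octahedra

andAll-cong : ∀ m {f g : Fin m → Bool} → (∀ i → f i ≡ g i) → andAll m f ≡ andAll m g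
andAll-cong zero    eq = refl
andAll-cong (suc m) eq = cong₂ _∧_ (eq zero) (andAll-cong m (eq ∘ suc))

hasFace-cong : {P P′ : Fin m → Pair n} → P ≗ P′ → ∀ f → hasFace P f ≡ hasFace P′ f
hasFace-cong P≗ f = andAll-cong _ λ i → cong (f i ∈₂?_) (P≗ i)

decompose : (u : Pair (4 + n)) → ∃ λ v → ∃ λ w → u ≐ v ⊕ w
decompose ⟨ suc c , suc d ∣ s≤s c<d ⟩ = star c , star d , chord≐star⊕star c<d
decompose u@(⟨ zero , suc b ∣ _ ⟩) with avoid₂ b b
... | c , b≢c , _ with <-cmp b c
...   | tri≈ _ b≡c _ = contradiction b≡c b≢c
...   | tri< b<c _ _ = star c , chord b<c , λ x → sym (trans
  (cong ((x ∈₂? star c) xor_) (chord≐star⊕star b<c x))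
  (solve 2 (λ p q → p :+ (q :+ p) := q) refl (x ∈₂? star c) (x ∈₂? u)))
...   | tri> _ _ c<b = star c , chord c<b , λ x → sym (trans
  (cong ((x ∈₂? star c) xor_) (chord≐star⊕star c<b x))
  (solve 2 (λ p q → p :+ (p :+ q) := q) refl (x ∈₂? star c) (x ∈₂? u)))

fromEnds : Fin (suc (suc n)) → Fin (suc (suc n)) → Pair (suc (suc n))
fromEnds u v with u <? v
... | yes u<v = ⟨ u , v ∣ u<v ⟩
-- A default for ends out of order, never reached from an encoded pair.
... | no  _   = star zero

fromEnds-ends : (p : Pair (suc (suc n))) → fromEnds (a p) (b p) ≡ p
fromEnds-ends ⟨ u , v ∣ u<v ⟩ with u <? v
... | yes u<v′ = cong ⟨ u , v ∣_⟩ (≤-irrelevant u<v′ u<v)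
... | no  u≮v  = contradiction u<v u≮v

decodePair : Fin (suc (suc n) * suc (suc n)) → Pair (suc (suc n))
decodePair {n} i = uncurry fromEnds (remQuot {suc (suc n)} (suc (suc n)) i)

encodePair : Pair (suc (suc n)) → Fin (suc (suc n) * suc (suc n))
encodePair p = combine (a p) (b p)

decode-encodePair : (p : Pair (suc (suc n))) → decodePair (encodePair p) ≡ p
decode-encodePair p = trans
  (cong (uncurry fromEnds) (remQuot-combine (a p) (b p)))
  (fromEnds-ends p)

-- A finite enumeration with repetitions, onto up to pointwise equality, on which `gauss` can run.
decode : Fin ((suc (suc n) * suc (suc n)) ^ m) → Fin m → Pair (suc (suc n))
decode i j = decodePair (finToFun i j)

encode : (Fin m → Pair (suc (suc n))) → Fin ((suc (suc n) * suc (suc n)) ^ m)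
encode P = funToFin (encodePair ∘ P)

decode-encode : (P : Fin m → Pair (suc (suc n))) → decode (encode P) ≗ P
decode-encode P j = trans
  (cong decodePair (finToFun-funToFin (encodePair ∘ P) j)) (decode-encodePair (P j))

-- From an (n,k)-matrix to a form

module _ {n k : ℕ} {A : Matrix k (4 + n)} (isNK : IsNKMatrix (4 + n) k A) where
  open IsNKMatrix isNK

  -- Pointwise equal octahedra have the same faces, so they are the symmetric difference of the same
  -- two octahedra, and additivity gives both the same value.
  matrix-respectsˡ : ∀ {P P′} Q → P ≗ P′ → A P Q ≡ A P′ Q
  matrix-respectsˡ {P} {P′} Q P≗P′ with decompose (P zero)
  ... | v , w , P₀≐ = trans
    (additive P (v ∷ (P ∘ suc)) (w ∷ (P ∘ suc)) Q faces)
    (sym (additive P′ (v ∷ (P ∘ suc)) (w ∷ (P ∘ suc)) Q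
      λ f → trans (hasFace-cong (sym ∘ P≗P′) f) (faces f)))
    where
    faces : IsSymDiff P (v ∷ (P ∘ suc)) (w ∷ (P ∘ suc))
    faces f = hasFace-head {u = P zero} {v} {w} P₀≐ (P ∘ suc) f

  matrix-isForm : IsForm A
  matrix-isForm = record
    { respects = λ {P} {P′} {Q} {Q′} P≗ Q≗ → trans (matrix-respectsˡ Q P≗)
        (trans (symmetric P′ Q) (trans (matrix-respectsˡ P′ Q≗) (symmetric Q′ P′)))
    ; addˡ = λ {P} {P₁} {P₂} faces Q → additive P P₁ P₂ Q faces
    ; addʳ = λ {P} {P₁} {P₂} faces Q → trans (symmetric Q P) (trans (additive P P₁ P₂ Q faces)
        (cong₂ _xor_ (symmetric P₁ Q) (symmetric P₂ Q)))
    }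

  -- The pairs {1,2} and {1,3} of `NormSum` are `star zero` and `star (suc zero)`; the fixed choice
  -- moves from the first coordinate to the last.
  matrix-halfSum : halfSum k A (star zero) (star (suc zero)) (star zero) (star (suc zero)) ≡ true
  matrix-halfSum = trans
    (halfSum≡fullSum-slice k matrix-isForm symmetric p q)
    (trans (sym (xorSumFun≡fullSum k (slice-isForm matrix-isForm p q) p q))
      (trans (xorSumFun-cong k λ t → IsForm.respects matrix-isForm
          (λ { zero → refl ; (suc i) → refl }) (λ { zero → refl ; (suc i) → refl }))
        normalised))
    where
    p q : Pair (4 + n)
    p = star zero
    q = star (suc zero)

-- The matrix M and the final count

module _ {j k : ℕ} {A : Matrix (suc k) (4 + j)} (isNK : IsNKMatrix (4 + j) (suc k) A) where
  open IsNKMatrix isNK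

  private
    isA : IsForm A
    isA = matrix-isForm isNK

    -- Here n is `4 + j`, giving n - 2 blocks of size n - 1. The dimension is `suc k`, so `2 ^ k` is
    -- the number of terms in an entry.
    Index : Set
    Index = Fin (2 + j) × Fin (3 + j)

    entry : Fin (2 + j) → Fin (2 + j) → Pair (4 + j) → Pair (4 + j) → Bool
    entry a a′ u v = halfSum k (slice A u v) (star (suc a)) (spoke a) (star (suc a′)) (spoke a′)

    -- The common off-diagonal value of the block (a , a′), subtracted below the
    -- block diagonal.
    correction : Fin (2 + j) → Fin (2 + j) → Bool
    correction a a′ = does (a′ <? a) ∧ entry a a′ (star zero) (star (suc zero))

    M : Index → Index → Bool
    M (a , b) (a′ , b′) = entry a a′ (star b) (star b′) xor correction a a′

    M-block : IsBlockMatrix M (λ _ _ → true)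
    M-block = record
      { diagonal = λ {a} {a′} {b} {b′} _ _ a′<a b≢b′ → trans
          (cong₂ (λ x d → x xor (d ∧ entry a a′ (star zero) (star (suc zero))))
            -- Distinct block indices make the picks disjoint, so the entry is constant off the
            -- diagonal and equals the correction.
            (star-constant
              (halfSum-slice-intersectionLike k isA disjoint
                (star-spoke-disjoint (<⇒≢ a′<a ∘ sym))
                (Disjoint-sym (star (suc a′)) (spoke a) (star-spoke-disjoint (<⇒≢ a′<a))))
              b≢b′ (λ ()))
            (dec-true (a′ <? a) a′<a))
          (xor-same (entry a a′ (star zero) (star (suc zero))))
      ; tournament = λ {a} {b} {b′} _ _ b≢b′ → trans
          (cong₂ _xor_ (uncorrected a b b′) (uncorrected a b′ b))
          -- The two opposite entries add up to a half sum of a twist of `A`, whose value is the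
          -- normalisation sum.
          (trans (sym (halfSum-⊞ k)) (trans (value a b≢b′) (matrix-halfSum isNK)))
      }
      where
      uncorrected : ∀ a b b′ → M (a , b) (a , b′) ≡ entry a a (star b) (star b′)
      uncorrected a b b′ = trans
        (cong (λ d → entry a a (star b) (star b′) xor (d ∧ entry a a (star zero) (star (suc zero))))
          (dec-false (a <? a) (<-irrefl refl)))
        (xor-identityʳ _)

      value : ∀ a {b b′} → b ≢ b′ →
        halfSum k (twist A (star b) (star b′) (star b) (star b′)) (star (suc a)) (spoke a) (star (suc a)) (spoke a) ≡
        halfSum (suc k) A (star zero) (star (suc zero)) (star zero) (star (suc zero))
      value a {b} {b′} b≢b′ = trans
        (halfSum-standard k (twist-isForm isA _ _ _ _) (twist-symmetric symmetric (star b) (star b′))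
          (twist-alternating symmetric (star b) (star b′))
          (twist-vanishing isA disjoint (stars b≢b′)) (star-spoke a))
        (halfSum-twist-standard k isA symmetric disjoint (stars (λ ())) (stars b≢b′))

    rank-M : ∀ {r} → RankAtMost r (λ x y → A (decode x) (decode y)) → RankAtMost (2 ^ k * r + suc j) M
    rank-M A≤ = rank-xor
      (rank-halfSum k (λ x y → slice A (star (proj₂ x)) (star (proj₂ y))) _ _ _ _ λ φ ψ →
        rank-cong (λ x y → IsForm.respects isA (decode-encode _) (decode-encode _))
          (rank-reindex (λ x → encode (star (proj₂ x) ∷ φ x)) (λ y → encode (star (proj₂ y) ∷ ψ y)) A≤))
      (rank-reindex {M = correction} proj₁ proj₁
        -- Row zero of `correction` vanishes, no block index being smaller; the other `suc j` rows,
        -- n - 3 in number, bound the rank.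
        (rank-extendByZeroRow {M = correction} (λ _ → refl) (rank-rows (correction ∘ suc))))

  rank-bound : ∀ {r} → RankAtMost r (λ x y → A (decode x) (decode y)) → suc j ^ 2 ≤ 2 ^ suc k * r
  -- The count yields one more than the square, and `n≤1+n` discards the surplus.
  rank-bound {r} A≤ = ≤-trans (n≤1+n _) (+-cancelʳ-≤ (2 * suc j + suc (suc j)) _ _ (begin
    suc (suc j ^ 2) + (2 * suc j + suc (suc j))
      ≡⟨ complete-square j ⟩
    (2 + j) * (3 + j)
      ≡⟨ sym (total-all (2 + j) (3 + j)) ⟩
    total {2 + j} {3 + j} (λ _ _ → true)
      ≤⟨ rank-blocks (2 + j) (3 + j) _ M-block (rank-M A≤) ⟩
    (2 ^ k * r + suc j) + (2 ^ k * r + suc j) + (2 + j)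
      ≡⟨ collect (2 ^ k) r j ⟩
    2 ^ suc k * r + (2 * suc j + suc (suc j)) ∎))
    where open ≤-Reasoning

theorem1p5 : (k n : ℕ) → 1 ≤ k → 4 ≤ n →
    (A : Matrix k n) → IsNKMatrix n k A →
    Σ ℕ (λ r → RankAtLeast A r × (n ∸ 3) ^ 2 ≤ 2 ^ k * r)
theorem1p5 (suc k) (suc (suc (suc (suc j)))) _ (s≤s (s≤s (s≤s (s≤s _)))) A isNK
  with gauss (λ x y → A (decode x) (decode y))
... | r , A≤ , ρ , independent =
  -- A combination vanishing on all columns vanishes on the enumerated ones, so independence over
  -- the enumeration suffices.
  r , (decode ∘ ρ , λ c vanishes → independent c (vanishes ∘ decode)) , rank-bound isNK A≤
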